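{- Let $n\ge 1$ be an integer and let $x,y$ be complex numbers such that no denominator below vanishes, i.e. $x\notin\{ -1,\dots,-n\}$, $x-y\notin\{ -1,\dots,-n\}$ and $y\notin\{ -n,-n+1,\dots,n-1\}$. Then $$\sum_{k=0}^n(-1)^k\binom{n}{k}\frac{\binom{y+k}{k}}{\binom{y-n+k}{k}}\frac{y}{y+k}H_{k}^{\langle4\rangle}(x)=\frac{(-1)^n}{6n}\,\frac{\binom{x-y+n}{n}}{\binom{x+n}{n}\binom{y}{n}}\Big\{\big[H_{n}(x-y)-H_{n}(x)\big]^3+2\big[H_{n}^{\langle3\rangle}(x-y)-H_{n}^{\langle3\rangle}(x)\big]$$ $$\qquad-3\big[H_{n}(x-y)-H_{n}(x)\big]\big[H_{n}^{\langle2\rangle}(x-y)-H_{n}^{\langle2\rangle}(x)\big]\Big\}.$$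
   Context: For a complex number $u$ and an integer $k\ge 0$, $\binom{u}{k}=\frac{u(u-1)\cdots(u-k+1)}{k!}$ (equal to $1$ for $k=0$). For a complex number $u$ and a positive integer $\ell$, the generalized harmonic numbers of $\ell$-order are $H_0^{\langle\ell\rangle}(u)=0$ and $H_n^{\langle\ell\rangle}(u)=\sum_{k=1}^n\frac{1}{(u+k)^\ell}$ for $n\ge1$; $H_n(u)=H_n^{\langle1\rangle}(u)$. -}

-- The library has no complex numbers, so everything is done over an arbitrary
-- Heyting field of characteristic zero.  ℂ is one: its apartness z # w is
-- "∣ z - w ∣ > 0", which classically is just z ≠ w.
module Defs where

open import Data.Nat.Base as ℕ using (ℕ; zero; suc; z≤n; s≤s; _!)
import Data.Nat.Properties as ℕ
open import Data.Integer.Base as ℤ using (ℤ; +_; -[1+_]; -1ℤ)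
import Data.Integer.Properties as ℤ
open import Data.Fin.Base using (Fin; zero; suc; toℕ)
import Data.Fin.Properties as Fin
open import Data.Product.Base using (_,_; proj₁; proj₂)
open import Relation.Binary.PropositionalEquality as ≡ using (_≡_)
open import Algebra.Bundles using (CommutativeRing; Semiring)
open import Algebra.Apartness.Bundles using (HeytingField; HeytingCommutativeRing)
import Algebra.Definitions.RawSemiring as RawSemiring
import Algebra.Properties.Ring
import Algebra.Properties.CommutativeSemigroup
import Algebra.Properties.Monoid.Mult
import Algebra.Properties.Monoid.Sum
import Algebra.Apartness.Properties.HeytingCommutativeRing
import Relation.Binary.Reasoning.Setoid

CharacteristicZero : ∀ {c ℓ₁ ℓ₂} → HeytingField c ℓ₁ ℓ₂ → Set ℓ₂
CharacteristicZero F = ∀ n → (suc n × 1#) # 0#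
  where
  open HeytingField F
  open HeytingCommutativeRing heytingCommutativeRing using (commutativeRing)
  open CommutativeRing commutativeRing using (semiring)
  open Semiring semiring using (rawSemiring)
  open RawSemiring rawSemiring using (_×_)

6n≥1 : ∀ {n} → 1 ℕ.≤ n → 1 ℕ.≤ 6 ℕ.* n
6n≥1 (s≤s _) = s≤s z≤n

module Harmonic {c ℓ₁ ℓ₂} (F : HeytingField c ℓ₁ ℓ₂)
                (char0 : CharacteristicZero F) where

  open HeytingField F hiding (zero)
  open HeytingCommutativeRing heytingCommutativeRing using (commutativeRing)
  open CommutativeRing commutativeRing using (ring; semiring)
  open Semiring semiring using (rawSemiring; +-monoid; +-commutativeSemigroup)
  open Algebra.Properties.Ring ring using (-‿involutive)
  open Algebra.Properties.Monoid.Mult +-monoid using (×-homo-+)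
  open Algebra.Properties.CommutativeSemigroup +-commutativeSemigroup
    using (xy∙z≈xz∙y)
  open Algebra.Apartness.Properties.HeytingCommutativeRing heytingCommutativeRing
    using (x-0≈x; 1#0; x#0y#0→xy#0; #-congʳ; #-congˡ; invertibleˡ⇒#)
  open Relation.Binary.Reasoning.Setoid setoid

  open RawSemiring rawSemiring public using (_×_; _^_; product)
  open Algebra.Properties.Monoid.Sum +-monoid public
    using (sum-syntax; sum⁺-syntax)

  infixl 10 product-syntax

  product-syntax : ∀ n → (Fin n → Carrier) → Carrier
  product-syntax _ = product

  syntax product-syntax n (λ i → x) = ∏[ i < n ] x

  ι : ℕ → Carrier
  ι n = n × 1#

  ιℤ : ℤ → Carrier
  ιℤ (+ n)    = ι n
  ιℤ -[1+ n ] = - ι (suc n)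

  -- u ∉ {a, a+1, …, b}
  infix 4 _∉ℤ[_⋯_]
  _∉ℤ[_⋯_] : Carrier → ℤ → ℤ → Set ℓ₂
  u ∉ℤ[ a ⋯ b ] = ∀ j → a ℤ.≤ j → j ℤ.≤ b → u # ιℤ j

  -- #⇒invertible inverts y - 0# rather than y.
  infixl 7 _/_[_]
  _/_[_] : (x y : Carrier) → y # 0# → Carrier
  x / y [ y#0 ] = x * proj₁ (#⇒invertible y#0)

  private
    m-n#0 : ∀ {u v} → u # v → (u - v) # 0#
    m-n#0 {u} {v} u#v = invertibleˡ⇒# (proj₁ inv , (begin
      proj₁ inv * ((u - v) - 0#)  ≈⟨ *-congˡ (x-0≈x (u - v)) ⟩
      proj₁ inv * (u - v)         ≈⟨ proj₁ (proj₂ inv) ⟩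
      1#                          ∎))
      where inv = #⇒invertible u#v

    m+n#0 : ∀ {u v} → u # (- v) → (u + v) # 0#
    m+n#0 u#-v = #-congʳ (+-congˡ (-‿involutive _)) (m-n#0 u#-v)

    cancel : ∀ u v → (u + v) - v ≈ u
    cancel u v = begin
      (u + v) - v  ≈⟨ +-assoc u v (- v) ⟩
      u + (v - v)  ≈⟨ +-congˡ (-‿inverseʳ v) ⟩
      u + 0#       ≈⟨ +-identityʳ u ⟩
      u            ∎

    cancel′ : ∀ u v → (u - v) + v ≈ u
    cancel′ u v = begin
      (u - v) + v    ≈⟨ +-assoc u (- v) v ⟩
      u + (- v + v)  ≈⟨ +-congˡ (-‿inverseˡ v) ⟩
      u + 0#         ≈⟨ +-identityʳ u ⟩
      u              ∎

    ι-+ : ∀ a b {c d} → a ℕ.+ b ≡ c ℕ.+ d → ι a + ι b ≈ ι c + ι d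
    ι-+ a b {c} {d} eq = begin
      ι a + ι b    ≈⟨ ×-homo-+ 1# a b ⟨
      ι (a ℕ.+ b)  ≡⟨ ≡.cong ι eq ⟩
      ι (c ℕ.+ d)  ≈⟨ ×-homo-+ 1# c d ⟩
      ι c + ι d    ∎

    transpose : ∀ {p q a b} → p + b ≈ q + a → p - a ≈ q - b
    transpose {p} {q} {a} {b} eq = begin
      p - a              ≈⟨ +-congʳ (cancel p b) ⟨
      ((p + b) - b) - a  ≈⟨ +-congʳ (+-congʳ eq) ⟩
      ((q + a) - b) - a  ≈⟨ xy∙z≈xz∙y (q + a) (- b) (- a) ⟩
      ((q + a) - a) - b  ≈⟨ +-congʳ (cancel q a) ⟩
      q - b              ∎

    product#0 : ∀ {n} {f : Fin n → Carrier} → (∀ i → f i # 0#) → product f # 0#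
    product#0 {zero}  f#0 = 1#0
    product#0 {suc n} f#0 =
      x#0y#0→xy#0 (f#0 zero) (product#0 λ i → f#0 (suc i))

    /#0 : ∀ {u v} (v#0 : v # 0#) → u # 0# → (u / v [ v#0 ]) # 0#
    /#0 {u} {v} v#0 u#0 = x#0y#0→xy#0 u#0 (invertibleˡ⇒# (v , (begin
      v * (proj₁ inv - 0#)  ≈⟨ *-congˡ (x-0≈x _) ⟩
      v * proj₁ inv         ≈⟨ *-congʳ (x-0≈x v) ⟨
      (v - 0#) * proj₁ inv  ≈⟨ proj₂ (proj₂ inv) ⟩
      1#                    ∎)))
      where inv = #⇒invertible v#0

  ι#0 : ∀ {n} → 1 ℕ.≤ n → ι n # 0#
  ι#0 (s≤s {n = n} _) = char0 n

  ^#0 : ∀ {u} n → u # 0# → (u ^ n) # 0#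
  ^#0 zero    u#0 = 1#0
  ^#0 (suc n) u#0 = x#0y#0→xy#0 u#0 (^#0 n u#0)

  binom : Carrier → ℕ → Carrier
  binom u k = (∏[ i < k ] (u - ι (toℕ i))) / ι (k !) [ ι#0 (ℕ.1≤n! k) ]

  u+k#0 : ∀ {u n} → u ∉ℤ[ ℤ.- + n ⋯ -1ℤ ] → (k : Fin n) →
          (u + ι (suc (toℕ k))) # 0#
  u+k#0 u∉ k = m+n#0
    (u∉ -[1+ toℕ k ] (ℤ.neg-mono-≤ (ℤ.+≤+ (Fin.toℕ<n k))) (ℤ.-≤- z≤n))

  -- H ℓ n u _ is the harmonic number H_n^⟨ℓ⟩(u).
  H : ∀ (ℓ n : ℕ) (u : Carrier) → u ∉ℤ[ ℤ.- + n ⋯ -1ℤ ] → Carrier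
  H ℓ n u u∉ =
    ∑[ k < n ] (1# / (u + ι (suc (toℕ k))) ^ ℓ [ ^#0 ℓ (u+k#0 u∉ k) ])

  ∉-≤ : ∀ {u n} → u ∉ℤ[ ℤ.- + n ⋯ -1ℤ ] → (k : Fin (suc n)) →
        u ∉ℤ[ ℤ.- + toℕ k ⋯ -1ℤ ]
  ∉-≤ u∉ k j -k≤j = u∉ j
    (ℤ.≤-trans (ℤ.neg-mono-≤ (ℤ.+≤+ (Fin.toℕ≤pred[n] k))) -k≤j)

  binom[u+n,n]#0 : ∀ {u n} → u ∉ℤ[ ℤ.- + n ⋯ -1ℤ ] → binom (u + ι n) n # 0#
  binom[u+n,n]#0 {u} {n} u∉ = /#0 _ (product#0 factor#0)
    where
    factor#0 : (i : Fin n) → ((u + ι n) - ι (toℕ i)) # 0#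
    factor#0 i = #-congʳ eq
      (m+n#0 (u∉ -[1+ m ] (ℤ.neg-mono-≤ (ℤ.+≤+ 1+m≤n)) (ℤ.-≤- z≤n)))
      where
      m = n ℕ.∸ suc (toℕ i)

      1+m+i≡n : suc m ℕ.+ toℕ i ≡ n
      1+m+i≡n = ≡.trans (≡.sym (ℕ.+-suc m (toℕ i))) (ℕ.m∸n+n≡m (Fin.toℕ<n i))

      1+m≤n : suc m ℕ.≤ n
      1+m≤n = ≡.subst (suc m ℕ.≤_) 1+m+i≡n (ℕ.m≤m+n (suc m) (toℕ i))

      eq : u + ι (suc m) ≈ (u + ι n) - ι (toℕ i)
      eq = begin
        u + ι (suc m)                              ≈⟨ cancel _ _ ⟨
        ((u + ι (suc m)) + ι (toℕ i)) - ι (toℕ i)  ≈⟨ +-congʳ (+-assoc _ _ _) ⟩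
        (u + (ι (suc m) + ι (toℕ i))) - ι (toℕ i)  ≈⟨ +-congʳ (+-congˡ (×-homo-+ 1# (suc m) (toℕ i))) ⟨
        (u + ι (suc m ℕ.+ toℕ i)) - ι (toℕ i)      ≡⟨ ≡.cong (λ t → (u + ι t) - ι (toℕ i)) 1+m+i≡n ⟩
        (u + ι n) - ι (toℕ i)                      ∎

  module _ {y : Carrier} {n : ℕ} (y∉ : y ∉ℤ[ ℤ.- + n ⋯ + n ℤ.- + 1 ]) where

    private
      y-m#0 : ∀ {m} → m ℕ.< n → (y - ι m) # 0#
      y-m#0 {m} m<n@(s≤s m≤n-1) = m-n#0 (y∉ (+ m) ℤ.neg-≤-pos (ℤ.+≤+ m≤n-1))

    y+k#0 : 1 ℕ.≤ n → (k : Fin (suc n)) → (y + ι (toℕ k)) # 0#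
    y+k#0 (s≤s _) zero    = m+n#0 (#-congˡ 0≈-0 (y∉ (+ 0) ℤ.neg-≤-pos (ℤ.+≤+ z≤n)))
      where
      0≈-0 : 0# ≈ - 0#
      0≈-0 = trans (sym (-‿inverseʳ 0#)) (+-identityˡ (- 0#))
    y+k#0 (s≤s _) (suc k) = m+n#0
      (y∉ -[1+ toℕ k ] (ℤ.neg-mono-≤ (ℤ.+≤+ (Fin.toℕ<n k))) ℤ.-≤+)

    binom[y,n]#0 : binom y n # 0#
    binom[y,n]#0 = /#0 _ (product#0 λ i → y-m#0 (Fin.toℕ<n i))

    binom[y-n+k,k]#0 : (k : Fin (suc n)) →
                       binom (y - ι n + ι (toℕ k)) (toℕ k) # 0#
    binom[y-n+k,k]#0 k = /#0 _ (product#0 factor#0)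
      where
      k≤n = Fin.toℕ≤pred[n] k

      factor#0 : (i : Fin (toℕ k)) →
                 ((y - ι n + ι (toℕ k)) - ι (toℕ i)) # 0#
      factor#0 i = #-congʳ (transpose eq) (y-m#0 m<n)
        where
        m = n ℕ.∸ toℕ k ℕ.+ toℕ i

        m<n : m ℕ.< n
        m<n = ≡.subst (m ℕ.<_) (ℕ.m∸n+n≡m k≤n)
                (ℕ.+-monoʳ-< (n ℕ.∸ toℕ k) (Fin.toℕ<n i))

        i+n≡k+m : toℕ i ℕ.+ n ≡ toℕ k ℕ.+ m
        i+n≡k+m = ≡.trans (ℕ.+-comm (toℕ i) n)
          (≡.trans (≡.cong (ℕ._+ toℕ i) (≡.sym (ℕ.m+[n∸m]≡n k≤n)))
                   (ℕ.+-assoc (toℕ k) (n ℕ.∸ toℕ k) (toℕ i)))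

        eq : y + ι (toℕ i) ≈ (y - ι n + ι (toℕ k)) + ι m
        eq = begin
          y + ι (toℕ i)                      ≈⟨ +-congʳ (cancel′ y (ι n)) ⟨
          ((y - ι n) + ι n) + ι (toℕ i)      ≈⟨ +-assoc _ _ _ ⟩
          (y - ι n) + (ι n + ι (toℕ i))      ≈⟨ +-congˡ (+-comm _ _) ⟩
          (y - ι n) + (ι (toℕ i) + ι n)      ≈⟨ +-congˡ (ι-+ (toℕ i) n {toℕ k} {m} i+n≡k+m) ⟩
          (y - ι n) + (ι (toℕ k) + ι m)      ≈⟨ +-assoc _ _ _ ⟨
          (y - ι n + ι (toℕ k)) + ι m        ∎

  *#0 : ∀ {u v} → u # 0# → v # 0# → (u * v) # 0#
  *#0 = x#0y#0→xy#0

{-# OPTIONS --safe #-}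
-- Write α u k = binom (u + k, k) and δ u k = (u)ₖ / k!. The coefficient of
-- H_k⁽⁴⁾(x) on the left is δ y k δ (-y) (n - k) / δ (-y) n, which is
-- Gosper-summable, so summation by parts turns the left-hand side into a
-- multiple of A 4 n, where A m n = Σ_{j<n} α y j α (-y) (n - 1 - j) / (x + j + 1)ᵐ.
-- Up to the factor - y the weights of A are the residues of
-- f(x) = Π (x - y + i) / (x + i), i.e. y A 1 = 1 - f, and so 6 y A 4 is f‴, which
-- the logarithmic derivative of f expresses by harmonic numbers. Instead of
-- differentiating, the formulas for A 1, …, A 4 are proved by induction on n
-- from one recurrence that relates A (m + 1) and A m.
module Submission where

open import Data.Nat.Base as ℕ using (ℕ; zero; suc; s≤s; z≤n; z<s; s<s; _∸_; _!)
import Data.Nat.Properties as ℕ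
open import Data.Integer.Base as ℤ using (ℤ; +_; -[1+_]; -1ℤ; _⊖_)
import Data.Integer.Properties as ℤ
open import Data.Fin.Base using (Fin; zero; suc; toℕ)
import Data.Fin.Properties as Fin
open import Data.Maybe.Base using (Maybe; nothing; just)
open import Data.Product.Base using (_,_; proj₁; proj₂; ∃)
open import Function.Base using (_∘_)
open import Relation.Binary.PropositionalEquality as ≡ using (_≡_)
open import Relation.Nullary using (yes; no)
open import Algebra.Bundles using (CommutativeRing; Monoid)
open import Algebra.Apartness.Bundles using (HeytingField; HeytingCommutativeRing)
open import Algebra.Solver.Ring.AlmostCommutativeRing
  using (fromCommutativeRing; _-Raw-AlmostCommutative⟶_)
import Algebra.Solver.Ring
import Algebra.Properties.Ring
import Algebra.Properties.AbelianGroup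
import Algebra.Properties.Monoid.Sum
import Algebra.Properties.Semiring.Sum
import Algebra.Properties.Semiring.Mult
import Algebra.Properties.CommutativeSemiring.Exp
import Algebra.Apartness.Properties.HeytingCommutativeRing
import Relation.Binary.Reasoning.Setoid
open import Defs

-- A ring solver with integer coefficients over any commutative ring.

module IntegerSolver {c ℓ} (R : CommutativeRing c ℓ) where

  open CommutativeRing R
  open Algebra.Properties.Ring ring
    using (-‿involutive; -‿distribˡ-*; -‿distribʳ-*; -0#≈0#)
  open Algebra.Properties.AbelianGroup +-abelianGroup using (⁻¹-∙-comm; xyx⁻¹≈y)
  open Algebra.Properties.Semiring.Mult semiring using (_×_; ×-homo-+; ×1-homo-*)
  open Relation.Binary.Reasoning.Setoid setoid

  -- On nonnegative integers this is definitionally `ι`, so `con (+ 2)` in a solver call matches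
  -- `ι 2` in a goal.
  ⟦_⟧ℤ : ℤ → Carrier
  ⟦ + n ⟧ℤ      = n × 1#
  ⟦ -[1+ n ] ⟧ℤ = - (suc n × 1#)

  private
    ⟦-⟧ : ∀ n → ⟦ ℤ.- + n ⟧ℤ ≈ - (n × 1#)
    ⟦-⟧ zero    = sym -0#≈0#
    ⟦-⟧ (suc n) = refl

    -- Integer sums with mixed signs compute to `⊖`, so both mixed cases of `+-homo` are instances.
    ⟦⊖⟧ : ∀ m n → ⟦ m ⊖ n ⟧ℤ ≈ m × 1# - n × 1#
    ⟦⊖⟧ m zero = begin
      m × 1#         ≈⟨ +-identityʳ _ ⟨
      m × 1# + 0#    ≈⟨ +-congˡ -0#≈0# ⟨
      m × 1# - 0#    ∎
    ⟦⊖⟧ zero (suc n) = sym (+-identityˡ _)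
    ⟦⊖⟧ (suc m) (suc n) = begin
      ⟦ suc m ⊖ suc n ⟧ℤ             ≡⟨ ≡.cong ⟦_⟧ℤ (ℤ.[1+m]⊖[1+n]≡m⊖n m n) ⟩
      ⟦ m ⊖ n ⟧ℤ                     ≈⟨ ⟦⊖⟧ m n ⟩
      a - b                          ≈⟨ +-congʳ (xyx⁻¹≈y 1# a) ⟨
      (1# + a - 1#) - b              ≈⟨ +-assoc _ _ _ ⟩
      (1# + a) + (- 1# - b)          ≈⟨ +-congˡ (⁻¹-∙-comm 1# b) ⟩
      (1# + a) - (1# + b)            ∎
      where
      a = m × 1#
      b = n × 1#

    +-homo : ∀ i j → ⟦ i ℤ.+ j ⟧ℤ ≈ ⟦ i ⟧ℤ + ⟦ j ⟧ℤ
    +-homo (+ m)      (+ n)      = ×-homo-+ 1# m n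
    +-homo (+ m)      -[1+ n ]   = ⟦⊖⟧ m (suc n)
    +-homo -[1+ m ]   (+ n)      = trans (⟦⊖⟧ n (suc m)) (+-comm _ _)
    +-homo -[1+ m ]   -[1+ n ]   = begin
      - (suc (suc (m ℕ.+ n)) × 1#)          ≡⟨ ≡.cong (λ k → - (k × 1#)) (≡.sym (≡.cong suc (ℕ.+-suc m n))) ⟩
      - ((suc m ℕ.+ suc n) × 1#)            ≈⟨ -‿cong (×-homo-+ 1# (suc m) (suc n)) ⟩
      - (suc m × 1# + suc n × 1#)           ≈⟨ ⁻¹-∙-comm _ _ ⟨
      - (suc m × 1#) - suc n × 1#           ∎

    -‿homo : ∀ i → ⟦ ℤ.- i ⟧ℤ ≈ - ⟦ i ⟧ℤ
    -‿homo (+ n)    = ⟦-⟧ n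
    -‿homo -[1+ n ] = sym (-‿involutive _)

    *-homo⁺ : ∀ m n → ⟦ + m ℤ.* + n ⟧ℤ ≈ ⟦ + m ⟧ℤ * ⟦ + n ⟧ℤ
    *-homo⁺ m n = begin
      ⟦ + m ℤ.* + n ⟧ℤ   ≡⟨ ≡.cong ⟦_⟧ℤ (ℤ.pos-* m n) ⟨
      (m ℕ.* n) × 1#     ≈⟨ ×1-homo-* m n ⟩
      m × 1# * n × 1#    ∎

    *-homo : ∀ i j → ⟦ i ℤ.* j ⟧ℤ ≈ ⟦ i ⟧ℤ * ⟦ j ⟧ℤ
    *-homo (+ m) (+ n) = *-homo⁺ m n
    *-homo (+ m) -[1+ n ] = begin
      ⟦ + m ℤ.* -[1+ n ] ⟧ℤ         ≡⟨ ≡.cong ⟦_⟧ℤ (ℤ.neg-distribʳ-* (+ m) (+ suc n)) ⟨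
      ⟦ ℤ.- (+ m ℤ.* + suc n) ⟧ℤ    ≈⟨ -‿homo (+ m ℤ.* + suc n) ⟩
      - ⟦ + m ℤ.* + suc n ⟧ℤ        ≈⟨ -‿cong (*-homo⁺ m (suc n)) ⟩
      - (m × 1# * suc n × 1#)       ≈⟨ -‿distribʳ-* _ _ ⟩
      m × 1# * - (suc n × 1#)       ∎
    *-homo -[1+ m ] (+ n) = begin
      ⟦ -[1+ m ] ℤ.* + n ⟧ℤ         ≡⟨ ≡.cong ⟦_⟧ℤ (ℤ.neg-distribˡ-* (+ suc m) (+ n)) ⟨
      ⟦ ℤ.- (+ suc m ℤ.* + n) ⟧ℤ    ≈⟨ -‿homo (+ suc m ℤ.* + n) ⟩
      - ⟦ + suc m ℤ.* + n ⟧ℤ        ≈⟨ -‿cong (*-homo⁺ (suc m) n) ⟩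
      - (suc m × 1# * n × 1#)       ≈⟨ -‿distribˡ-* _ _ ⟩
      - (suc m × 1#) * n × 1#       ∎
    *-homo -[1+ m ] -[1+ n ] = begin
      ⟦ + suc m ℤ.* + suc n ⟧ℤ            ≈⟨ *-homo⁺ (suc m) (suc n) ⟩
      suc m × 1# * suc n × 1#             ≈⟨ -‿involutive _ ⟨
      - - (suc m × 1# * suc n × 1#)       ≈⟨ -‿cong (-‿distribʳ-* _ _) ⟩
      - (suc m × 1# * - (suc n × 1#))     ≈⟨ -‿distribˡ-* _ _ ⟩
      - (suc m × 1#) * - (suc n × 1#)     ∎

    morphism : ℤ.+-*-rawRing -Raw-AlmostCommutative⟶ fromCommutativeRing R
    morphism = record
      { ⟦_⟧    = ⟦_⟧ℤ
      ; +-homo = +-homo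
      ; *-homo = *-homo
      ; -‿homo = -‿homo
      ; 0-homo = refl
      ; 1-homo = +-identityʳ 1#
      }

    _≟_ : ∀ i j → Maybe (⟦ i ⟧ℤ ≈ ⟦ j ⟧ℤ)
    i ≟ j with i ℤ.≟ j
    ... | yes i≡j = just (reflexive (≡.cong ⟦_⟧ℤ i≡j))
    ... | no  _   = nothing

  open Algebra.Solver.Ring ℤ.+-*-rawRing (fromCommutativeRing R) morphism _≟_ public
    using (Polynomial; solve; con; _:=_; _:+_; _:*_; _:-_; :-_; _:^_)

  -- con (+ 1) denotes 1# + 0#, whereas this denotes 1# itself.
  :1 : ∀ {n} → Polynomial n
  :1 = con (+ 0) :^ 0

module _ {c ℓ} (M : Monoid c ℓ) where
  open Monoid M
  open Algebra.Properties.Monoid.Sum M using (sum; sum-init-last; sum-cong-≗)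

  -- Terms are functions on ℕ composed with `toℕ`, so dropping the last index leaves the same
  -- function. Over a general monoid it serves sums and products alike.
  sum-last : ∀ n (f : ℕ → Carrier) →
             sum {suc n} (f ∘ toℕ) ≈ sum {n} (f ∘ toℕ) ∙ f n
  sum-last n f = trans (sum-init-last {n} (f ∘ toℕ)) (reflexive (≡.cong₂ _∙_
    (sum-cong-≗ {n} (≡.cong f ∘ Fin.toℕ-inject₁)) (≡.cong f (Fin.toℕ-fromℕ n))))

-- Division and cancellation in the field.

module Proof {ℓ₀ ℓ₁ ℓ₂} (F : HeytingField ℓ₀ ℓ₁ ℓ₂)
             (char0 : CharacteristicZero F) where

  open HeytingField F hiding (zero)
  open HeytingCommutativeRing heytingCommutativeRing using (commutativeRing)
  open CommutativeRing commutativeRing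
    using (semiring; commutativeSemiring; +-monoid; *-monoid)
  open Algebra.Properties.Semiring.Mult semiring using (×-homo-+; ×1-homo-*)
  open Algebra.Properties.CommutativeSemiring.Exp commutativeSemiring
    using (^-congˡ; ^-distrib-*)
  open Algebra.Properties.Semiring.Sum semiring
    using (sum; sum-cong-≋; ∑-distrib-+; *-distribˡ-sum)
  open Algebra.Properties.Monoid.Sum *-monoid
    using () renaming (sum-cong-≋ to product-cong)
  open Algebra.Apartness.Properties.HeytingCommutativeRing heytingCommutativeRing
    using (x-0≈x)
  open Harmonic F char0
  open IntegerSolver commutativeRing
  open Relation.Binary.Reasoning.Setoid setoid

  -- Lets the ring solver use a hypothesis `c ≈ d`: its multiple by the cofactor k is written out,
  -- and what remains is a polynomial identity.
  modulo : ∀ {a b c d} k → c ≈ d → a ≈ b + k * (c - d) → a ≈ b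
  modulo {a} {b} {c} {d} k c≈d a≈ = begin
    a                 ≈⟨ a≈ ⟩
    b + k * (c - d)   ≈⟨ +-congˡ (*-congˡ (trans (+-congʳ c≈d) (-‿inverseʳ d))) ⟩
    b + k * 0#        ≈⟨ +-congˡ (zeroʳ k) ⟩
    b + 0#            ≈⟨ +-identityʳ b ⟩
    b                 ∎

  modulo₂ : ∀ {a b c d e f} k l → c ≈ d → e ≈ f →
            a ≈ b + k * (c - d) + l * (e - f) → a ≈ b
  modulo₂ k l c≈d e≈f a≈ = modulo k c≈d (modulo l e≈f a≈)

  inverse : ∀ {z} (z#0 : z # 0#) → z * proj₁ (#⇒invertible z#0) ≈ 1#
  inverse {z} z#0 =
    trans (*-congʳ (sym (x-0≈x z))) (proj₂ (proj₂ (#⇒invertible z#0)))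

  /-*-cancel : ∀ w {z} (z#0 : z # 0#) → w / z [ z#0 ] * z ≈ w
  /-*-cancel w {z} z#0 = modulo w (inverse z#0)
    (solve 3 (λ w z i → w :* i :* z := w :+ w :* (z :* i :- :1)) refl _ _ _)

  *-cancelʳ : ∀ {a b z} → z # 0# → a * z ≈ b * z → a ≈ b
  *-cancelʳ {a} {b} {z} z#0 az≈bz = modulo₂ i (b - a) az≈bz (inverse z#0)
    (solve 4 (λ a b z i → a := b :+ i :* (a :* z :- b :* z)
                                 :+ (b :- a) :* (z :* i :- :1)) refl a b z i)
    where i = proj₁ (#⇒invertible z#0)

  -- Binomial coefficients and rising factorials.

  α δ : Carrier → ℕ → Carrier
  α u zero    = 1#
  α u (suc k) = (α u k * (u + ι (suc k))) / ι (suc k) [ char0 k ]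
  δ u zero    = 1#
  δ u (suc k) = (u * α u k) / ι (suc k) [ char0 k ]

  α-suc : ∀ u k → α u (suc k) * ι (suc k) ≈ α u k * (u + ι (suc k))
  α-suc u k = /-*-cancel _ (char0 k)

  δ-α : ∀ u k → δ u (suc k) * ι (suc k) ≈ u * α u k
  δ-α u k = /-*-cancel _ (char0 k)

  -- Pascal's rule. It makes `δ u` the difference sequence of `α u`, on which the antidifference in
  -- `difference` rests.
  α-δ : ∀ u k → α u (suc k) ≈ α u k + δ u (suc k)
  α-δ u k = *-cancelʳ (char0 k) (begin
    α u (suc k) * s             ≈⟨ α-suc u k ⟩
    α u k * (u + s)             ≈⟨ solve 3 (λ a u s → a :* (u :+ s) := a :* s :+ u :* a) refl (α u k) u s ⟩
    α u k * s + u * α u k       ≈⟨ +-congˡ (δ-α u k) ⟨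
    α u k * s + δ u (suc k) * s ≈⟨ distribʳ s _ _ ⟨
    (α u k + δ u (suc k)) * s   ∎)
    where s = ι (suc k)

  -- Absorbs the factor y / (y + k) of the theorem into `δ y k`; being free of division, it holds
  -- for every u.
  δ-shift : ∀ u k → δ u k * (u + ι k) ≈ u * α u k
  δ-shift u zero    = solve 1 (λ u → :1 :* (u :+ con (+ 0)) := u :* :1) refl u
  δ-shift u (suc k) = *-cancelʳ (char0 k) (begin
    δ u (suc k) * (u + s) * s   ≈⟨ solve 3 (λ d u s → d :* (u :+ s) :* s := (d :* s) :* (u :+ s)) refl (δ u (suc k)) u s ⟩
    δ u (suc k) * s * (u + s)   ≈⟨ *-congʳ (δ-α u k) ⟩
    u * α u k * (u + s)         ≈⟨ *-assoc _ _ _ ⟩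
    u * (α u k * (u + s))       ≈⟨ *-congˡ (α-suc u k) ⟨
    u * (α u (suc k) * s)       ≈⟨ *-assoc _ _ _ ⟨
    u * α u (suc k) * s         ∎)
    where s = ι (suc k)

  δ-suc : ∀ u k → δ u (suc k) * ι (suc k) ≈ δ u k * (u + ι k)
  δ-suc u k = trans (δ-α u k) (sym (δ-shift u k))

  binom-α : ∀ u k → binom (u + ι k) k ≈ α u k
  binom-α u k = *-cancelʳ (ι#0 (ℕ.1≤n! k))
    (trans (/-*-cancel _ (ι#0 (ℕ.1≤n! k))) (falling k))
    where
    falling : ∀ k → ∏[ i < k ] (u + ι k - ι (toℕ i)) ≈ α u k * ι (k !)
    falling zero    = solve 0 (:1 := :1 :* (:1 :+ con (+ 0))) refl
    falling (suc k) = begin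
      -- Once the first factor is split off, the others are those for `u + ι k`: numerator and index
      -- each drop by one.
      (u + s - 0#) * ∏[ i < k ] (u + s - ι (suc (toℕ i)))
        ≈⟨ *-cong (x-0≈x _) (product-cong {k} λ i →
             solve 4 (λ o u k i → u :+ (o :+ k) :- (o :+ i) := u :+ k :- i) refl 1# u (ι k) (ι (toℕ i))) ⟩
      (u + s) * ∏[ i < k ] (u + ι k - ι (toℕ i))
        ≈⟨ *-congˡ (falling k) ⟩
      (u + s) * (α u k * ι (k !))
        ≈⟨ solve 3 (λ v a p → v :* (a :* p) := a :* v :* p) refl _ _ _ ⟩
      α u k * (u + s) * ι (k !)
        ≈⟨ *-congʳ (α-suc u k) ⟨
      α u (suc k) * s * ι (k !)
        ≈⟨ *-assoc _ _ _ ⟩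
      α u (suc k) * (s * ι (k !))
        ≈⟨ *-congˡ (×1-homo-* (suc k) (k !)) ⟨
      α u (suc k) * ι (suc k !)     ∎
      where s = ι (suc k)

  -- One sign goes to each factor u - i and turns the falling factorial of u into the rising
  -- factorial of -u. As u stays fixed, the induction splits off the last factor.
  signed-binom : ∀ u k → (- 1#) ^ k * binom u k ≈ δ (- u) k
  signed-binom u k = *-cancelʳ (ι#0 (ℕ.1≤n! k)) (begin
    (- 1#) ^ k * binom u k * ι (k !)   ≈⟨ *-assoc _ _ _ ⟩
    (- 1#) ^ k * (binom u k * ι (k !)) ≈⟨ *-congˡ (/-*-cancel _ (ι#0 (ℕ.1≤n! k))) ⟩
    (- 1#) ^ k * product {k} (g ∘ toℕ) ≈⟨ falling k ⟩
    δ (- u) k * ι (k !)                ∎)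
    where
    g : ℕ → Carrier
    g i = u - ι i

    falling : ∀ k → (- 1#) ^ k * product {k} (g ∘ toℕ) ≈ δ (- u) k * ι (k !)
    falling zero    = solve 0 (:1 :* :1 := :1 :* (:1 :+ con (+ 0))) refl
    falling (suc k) = begin
      - 1# * (- 1#) ^ k * product {suc k} (g ∘ toℕ)
        ≈⟨ *-congˡ (sum-last *-monoid k g) ⟩
      - 1# * (- 1#) ^ k * (product {k} (g ∘ toℕ) * (u - ι k))
        ≈⟨ solve 4 (λ e p u k → :- :1 :* e :* (p :* (u :- k)) := e :* p :* (:- u :+ k)) refl _ _ u (ι k) ⟩
      (- 1#) ^ k * product {k} (g ∘ toℕ) * (- u + ι k)
        ≈⟨ *-congʳ (falling k) ⟩
      δ (- u) k * ι (k !) * (- u + ι k)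
        ≈⟨ solve 3 (λ d p v → d :* p :* v := d :* v :* p) refl _ _ _ ⟩
      δ (- u) k * (- u + ι k) * ι (k !)
        ≈⟨ *-congʳ (δ-suc (- u) k) ⟨
      δ (- u) (suc k) * ι (suc k) * ι (k !)
        ≈⟨ *-assoc _ _ _ ⟩
      δ (- u) (suc k) * (ι (suc k) * ι (k !))
        ≈⟨ *-congˡ (×1-homo-* (suc k) (k !)) ⟨
      δ (- u) (suc k) * ι (suc k !)     ∎

  -- Reflection of `δ` and convolution of `α`.

  suc∸ : ∀ {k n} → k ℕ.< n → n ∸ k ≡ suc (n ∸ suc k)
  suc∸ = ℕ.+-∸-assoc 1

  ι-split : ∀ {k n} → k ℕ.≤ n → ι n ≈ ι k + ι (n ∸ k)
  ι-split {k} {n} k≤n = trans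
    (reflexive (≡.cong ι (≡.sym (ℕ.m+[n∸m]≡n k≤n)))) (×-homo-+ 1# k (n ∸ k))

  -- The last k factors of the rising factorial of -y of length n, reversed and negated, are y - n +
  -- 1, ..., y - n + k; their k signs are those of `δ (- ι n) k`. In `weight` this produces the
  -- denominator binom(y - n + k, k).
  δ-reflect : ∀ y n k → k ℕ.≤ n →
              δ (- ι n) k * δ (- y) n ≈ α (y - ι n) k * δ (- y) (n ∸ k)
  δ-reflect y n zero    _   = refl
  δ-reflect y n (suc k) k<n = *-cancelʳ (char0 k) (begin
    δ (- N) (suc k) * δ (- y) n * s
      ≈⟨ solve 3 (λ d e s → d :* e :* s := d :* s :* e) refl _ _ s ⟩
    δ (- N) (suc k) * s * δ (- y) n
      ≈⟨ *-congʳ (δ-suc (- N) k) ⟩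
    δ (- N) k * (- N + ι k) * δ (- y) n
      ≈⟨ solve 3 (λ d e s → d :* s :* e := d :* e :* s) refl _ _ _ ⟩
    δ (- N) k * δ (- y) n * (- N + ι k)
      ≈⟨ *-congʳ (δ-reflect y n k (ℕ.<⇒≤ k<n)) ⟩
    α (y - N) k * δ (- y) (n ∸ k) * (- N + ι k)
      ≡⟨ ≡.cong (λ j → α (y - N) k * δ (- y) j * (- N + ι k)) (suc∸ k<n) ⟩
    α (y - N) k * δ (- y) (suc m) * (- N + ι k)
      ≈⟨ modulo₂ (- (α (y - N) k * δ (- y) (suc m))) (- α (y - N) k) N≈ (δ-suc (- y) m)
          (solve 7 (λ a d e n k m y →
            a :* d :* (:- n :+ k) :=
              a :* e :* (y :- (k :+ (:1 :+ m)) :+ (:1 :+ k))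
              :+ :- (a :* d) :* (n :- (k :+ (:1 :+ m)))
              :+ :- a :* (d :* (:1 :+ m) :- e :* (:- y :+ m)))
            refl _ _ _ N (ι k) (ι m) y) ⟩
    α (y - N) k * δ (- y) m * (y - (ι k + ι (suc m)) + s)
      ≈⟨ *-congˡ (+-congʳ (+-congˡ (-‿cong N≈))) ⟨
    α (y - N) k * δ (- y) m * (y - N + s)
      ≈⟨ solve 3 (λ d e s → d :* e :* s := d :* s :* e) refl _ _ _ ⟩
    α (y - N) k * (y - N + s) * δ (- y) m
      ≈⟨ *-congʳ (α-suc (y - N) k) ⟨
    α (y - N) (suc k) * s * δ (- y) m
      ≈⟨ solve 3 (λ d e s → d :* s :* e := d :* e :* s) refl _ _ _ ⟩
    α (y - N) (suc k) * δ (- y) m * s ∎)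
    where
    N = ι n
    s = ι (suc k)
    m = n ∸ suc k
    N≈ : N ≈ ι k + ι (suc m)
    N≈ = trans (ι-split (ℕ.<⇒≤ k<n)) (+-congˡ (reflexive (≡.cong ι (suc∸ k<n))))

  -- The generating function of `α u` is (1 - t)^(-u-1), so this is the coefficient of t^n in (1 -
  -- t)^(-y-1) (1 - t)^(y-1) = (1 - t)^(-2). The induction multiplies by the degree and distributes
  -- it over the two factors, as the Leibniz rule for t d/dt does.
  conv-α : ∀ y n → sum {suc n} ((λ j → α y j * α (- y) (n ∸ j)) ∘ toℕ) ≈ ι (suc n)
  conv-α y zero    = solve 0 (:1 :* :1 :+ con (+ 0) := :1 :+ con (+ 0)) refl
  conv-α y (suc n) = *-cancelʳ (char0 n) (begin
    sum {2 ℕ.+ n} (t ∘ toℕ) * s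
      ≈⟨ *-comm _ _ ⟩
    s * sum {2 ℕ.+ n} (t ∘ toℕ)
      ≈⟨ *-distribˡ-sum {2 ℕ.+ n} s (t ∘ toℕ) ⟩
    sum {2 ℕ.+ n} ((λ j → s * t j) ∘ toℕ)
      ≈⟨ sum-cong-≋ {2 ℕ.+ n} split ⟩
    sum {2 ℕ.+ n} ((λ j → a j + b j) ∘ toℕ)
      ≈⟨ ∑-distrib-+ {2 ℕ.+ n} (a ∘ toℕ) (b ∘ toℕ) ⟩
    sum {2 ℕ.+ n} (a ∘ toℕ) + sum {2 ℕ.+ n} (b ∘ toℕ)
      -- The factor `ι j` kills `a 0` and the factor `ι (suc n ∸ j)` kills `b (suc n)`; the
      -- surviving terms are paired as `a (suc j)` with `b j`.
      ≈⟨ +-cong (trans (+-congʳ (trans (*-congʳ (zeroʳ 1#)) (zeroˡ _))) (+-identityˡ _))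
          (trans (sum-last +-monoid (suc n) b)
            (trans (+-congˡ b-last) (+-identityʳ _))) ⟩
    sum {suc n} (a ∘ suc ∘ toℕ) + sum {suc n} (b ∘ toℕ)
      ≈⟨ ∑-distrib-+ {suc n} (a ∘ suc ∘ toℕ) (b ∘ toℕ) ⟨
    sum {suc n} ((λ j → a (suc j) + b j) ∘ toℕ)
      ≈⟨ sum-cong-≋ {suc n} merge ⟩
    sum {suc n} ((λ j → ι (2 ℕ.+ n) * (α y j * α (- y) (n ∸ j))) ∘ toℕ)
      ≈⟨ *-distribˡ-sum {suc n} _ ((λ j → α y j * α (- y) (n ∸ j)) ∘ toℕ) ⟨
    ι (2 ℕ.+ n) * sum {suc n} ((λ j → α y j * α (- y) (n ∸ j)) ∘ toℕ)
      ≈⟨ *-congˡ (conv-α y n) ⟩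
    ι (2 ℕ.+ n) * s ∎)
    where
    s = ι (suc n)
    t a b : ℕ → Carrier
    t j = α y j * α (- y) (suc n ∸ j)
    a j = α y j * ι j * α (- y) (suc n ∸ j)
    b j = α y j * (α (- y) (suc n ∸ j) * ι (suc n ∸ j))

    split : ∀ (i : Fin (2 ℕ.+ n)) → s * t (toℕ i) ≈ a (toℕ i) + b (toℕ i)
    split i = trans (*-congʳ (ι-split (Fin.toℕ≤pred[n] i)))
      (solve 4 (λ a b i j → (i :+ j) :* (a :* b) := a :* i :* b :+ a :* (b :* j))
        refl _ _ _ _)

    b-last : b (suc n) ≈ 0#
    b-last = trans
      (reflexive (≡.cong (λ j → α y (suc n) * (α (- y) j * ι j)) (ℕ.n∸n≡0 n)))
      (trans (*-congˡ (zeroʳ 1#)) (zeroʳ _))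

    merge : ∀ (i : Fin (suc n)) → a (suc (toℕ i)) + b (toℕ i) ≈
            ι (2 ℕ.+ n) * (α y (toℕ i) * α (- y) (n ∸ toℕ i))
    merge i = begin
      a (suc k) + α y k * (α (- y) (suc n ∸ k) * ι (suc n ∸ k))
        ≡⟨ ≡.cong (λ j → a (suc k) + α y k * (α (- y) j * ι j)) (suc∸ (s≤s k≤n)) ⟩
      α y (suc k) * ι (suc k) * β + α y k * (α (- y) (suc m) * ι (suc m))
        ≈⟨ +-cong (*-congʳ (α-suc y k)) (*-congˡ (α-suc (- y) m)) ⟩
      α y k * (y + ι (suc k)) * β + α y k * (β * (- y + ι (suc m)))
        -- The factors y + k + 1 and -y + m + 1 add up to n + 2, independent of y and of the index.
        ≈⟨ solve 6 (λ o a b y k m →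
             a :* (y :+ (o :+ k)) :* b :+ a :* (b :* (:- y :+ (o :+ m))) :=
             (o :+ (o :+ (k :+ m))) :* (a :* b)) refl 1# _ _ y (ι k) (ι m) ⟩
      (1# + (1# + (ι k + ι m))) * (α y k * β)
        ≈⟨ *-congʳ (+-congˡ (+-congˡ (ι-split k≤n))) ⟨
      ι (2 ℕ.+ n) * (α y k * β) ∎
      where
      k = toℕ i
      k≤n = Fin.toℕ≤pred[n] i
      m = n ∸ k
      β = α (- y) m

  sum-linear : ∀ n {a b c d : ℕ → Carrier} p q r →
    (∀ {j} → j ℕ.< n → a j ≈ p * b j + (q * c j - r * d j)) →
    sum {n} (a ∘ toℕ) ≈
    p * sum {n} (b ∘ toℕ) + (q * sum {n} (c ∘ toℕ) - r * sum {n} (d ∘ toℕ))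
  sum-linear zero    p q r _  = solve 3 (λ p q r → con (+ 0) :=
    p :* con (+ 0) :+ (q :* con (+ 0) :- r :* con (+ 0))) refl p q r
  sum-linear (suc n) p q r eq =
    trans (+-cong (eq z<s) (sum-linear n p q r (eq ∘ s<s)))
      (solve 9 (λ p q r b c d b′ c′ d′ →
        (p :* b :+ (q :* c :- r :* d)) :+ (p :* b′ :+ (q :* c′ :- r :* d′)) :=
        p :* (b :+ b′) :+ (q :* (c :+ c′) :- r :* (d :+ d′)))
        refl p q r _ _ _ _ _ _)

  -- Reciprocals and harmonic numbers.

  Reciprocals : Carrier → ℕ → (ℕ → Carrier) → Set ℓ₁
  Reciprocals x n u = ∀ {k} → k ℕ.< n → (x + ι (suc k)) * u k ≈ 1#

  -- Collecting the inverses into one function on ℕ frees the later inductions on n from apartness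
  -- proofs.
  reciprocals : ∀ n (z : ℕ → Carrier) → (∀ (i : Fin n) → z (toℕ i) # 0#) →
                ∃ λ (u : ℕ → Carrier) → ∀ {k} → k ℕ.< n → z k * u k ≈ 1#
  -- The value `0#` is a filler outside the range, where nothing is required of u.
  reciprocals zero    z z#0 = (λ _ → 0#) , λ ()
  reciprocals (suc n) z z#0 with reciprocals n (z ∘ suc) (z#0 ∘ suc)
  ... | u , zu≈1 = u′ , zu′≈1
    where
    u′ : ℕ → Carrier
    u′ zero    = proj₁ (#⇒invertible (z#0 zero))
    u′ (suc k) = u k

    zu′≈1 : ∀ {k} → k ℕ.< suc n → z k * u′ k ≈ 1#
    zu′≈1 {zero}  _         = inverse (z#0 zero)
    zu′≈1 {suc k} (s≤s k<n) = zu≈1 k<n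

  1^ : ∀ ℓ → 1# ^ ℓ ≈ 1#
  1^ zero    = refl
  1^ (suc ℓ) = trans (*-identityˡ _) (1^ ℓ)

  reciprocal-^ : ∀ ℓ {z v} → z * v ≈ 1# → {zˡ#0 : (z ^ ℓ) # 0#} →
                 1# / z ^ ℓ [ zˡ#0 ] ≈ v ^ ℓ
  reciprocal-^ ℓ {z} {v} zv≈1 {zˡ#0} = *-cancelʳ zˡ#0 (begin
    1# / z ^ ℓ [ zˡ#0 ] * z ^ ℓ   ≈⟨ /-*-cancel 1# zˡ#0 ⟩
    1#                            ≈⟨ 1^ ℓ ⟨
    1# ^ ℓ                        ≈⟨ ^-congˡ ℓ zv≈1 ⟨
    (z * v) ^ ℓ                   ≈⟨ ^-congˡ ℓ (*-comm z v) ⟩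
    (v * z) ^ ℓ                   ≈⟨ ^-distrib-* v z ℓ ⟩
    v ^ ℓ * z ^ ℓ                 ∎)

  -- Here and below the apartness proofs inside quotients are variables, so that
  -- unification with the theorem's sums never unfolds the proofs occurring there.
  H≈ : ∀ ℓ {n x u} → Reciprocals x n u →
       {z#0 : ∀ (i : Fin n) → ((x + ι (suc (toℕ i))) ^ ℓ) # 0#} →
       ∑[ i < n ] (1# / (x + ι (suc (toℕ i))) ^ ℓ [ z#0 i ]) ≈
       sum {n} ((λ k → u k ^ ℓ) ∘ toℕ)
  H≈ ℓ {n} xu≈1 = sum-cong-≋ {n} λ i → reciprocal-^ ℓ (xu≈1 (Fin.toℕ<n i))

  -- `H≈` with the first term split off, the shape to which `H 4 (toℕ k)` reduces when k is a
  -- successor.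
  H-suc≈ : ∀ ℓ {n x u} → Reciprocals x (suc n) u →
           {z₀#0 : ((x + ι 1) ^ ℓ) # 0#}
           {z#0 : ∀ (i : Fin n) → ((x + ι (2 ℕ.+ toℕ i)) ^ ℓ) # 0#} →
           1# / (x + ι 1) ^ ℓ [ z₀#0 ]
             + ∑[ i < n ] (1# / (x + ι (2 ℕ.+ toℕ i)) ^ ℓ [ z#0 i ]) ≈
           sum {suc n} ((λ k → u k ^ ℓ) ∘ toℕ)
  H-suc≈ ℓ {n} xu≈1 = +-cong (reciprocal-^ ℓ (xu≈1 z<s))
    (sum-cong-≋ {n} λ i → reciprocal-^ ℓ (xu≈1 (s<s (Fin.toℕ<n i))))

  -- Summation by parts with Gosper's antidifference.

  module _ (y : Carrier) (h : ℕ → Carrier) where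

    S : ℕ → Carrier
    S k = sum {k} (h ∘ toℕ)

    -- With n = i + j + 2, this says that n δ y k δ (-y) (n - k) is the difference
    -- in k of - y α y k α (-y) (n - 1 - k), Gosper's antidifference.
    difference : ∀ i j →
      (ι (suc i) + ι (suc j)) * (δ y (suc i) * δ (- y) (suc j)) ≈
      - y * (α y (suc i) * α (- y) j - α y i * α (- y) (suc j))
    difference i j = begin
      (s + t) * (d * e)
        ≈⟨ modulo₂ e d (δ-α y i) (δ-α (- y) j)
            (solve 7 (λ s t d e y a b →
              (s :+ t) :* (d :* e) :=
              :- y :* ((a :+ d) :* b :- a :* (b :+ e))
              :+ e :* (d :* s :- y :* a) :+ d :* (e :* t :- :- y :* b))
              refl s t d e y (α y i) (α (- y) j)) ⟩
      - y * ((α y i + d) * α (- y) j - α y i * (α (- y) j + e))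
        ≈⟨ *-congˡ (+-cong (*-congʳ (α-δ y i)) (-‿cong (*-congˡ (α-δ (- y) j)))) ⟨
      - y * (α y (suc i) * α (- y) j - α y i * α (- y) (suc j)) ∎
      where
      s = ι (suc i)
      t = ι (suc j)
      d = δ y (suc i)
      e = δ (- y) (suc j)

    -- For h k = `u k ^ 4` the sum of `tail n` over j < n is definitionally `A 4 n`.
    term tail : ℕ → ℕ → Carrier
    term n k = ι n * (δ y k * δ (- y) (n ∸ k) * S k)
    tail n j = α y j * α (- y) (n ∸ suc j) * h j

    -- Abel summation: the differences of the antidifference are moved onto `S`, whose increments
    -- are h, and one boundary term remains. The index k = 0 contributes nothing because `S 0` is
    -- empty. The bound m ≤ N keeps n - k positive, as `difference` demands.
    partial : ∀ N m → m ℕ.≤ N → sum {suc m} (term (suc N) ∘ toℕ) ≈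
      y * sum {m} (tail (suc N) ∘ toℕ) - y * (α y m * α (- y) (N ∸ m) * S m)
    partial N zero    _   = solve 4 (λ y n g b →
      n :* (:1 :* g :* con (+ 0)) :+ con (+ 0) :=
      y :* con (+ 0) :- y :* (:1 :* b :* con (+ 0)))
      refl y (ι (suc N)) (δ (- y) (suc N)) (α (- y) N)
    partial N (suc m) m<N = begin
      sum {2 ℕ.+ m} (term (suc N) ∘ toℕ)
        ≈⟨ sum-last +-monoid (suc m) (term (suc N)) ⟩
      sum {suc m} (term (suc N) ∘ toℕ) + ι (suc N) * (δ y (suc m) * δ (- y) (N ∸ m) * S (suc m))
        ≈⟨ +-cong (partial N m (ℕ.<⇒≤ m<N)) (*-congˡ (*-congˡ S-suc)) ⟩
      y * T - y * (α y m * α (- y) (N ∸ m) * S m)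
        + ι (suc N) * (δ y (suc m) * δ (- y) (N ∸ m) * (S m + h m))
        ≡⟨ ≡.cong (λ k → y * T - y * (α y m * α (- y) k * S m)
             + ι (suc N) * (δ y (suc m) * δ (- y) k * (S m + h m))) (suc∸ m<N) ⟩
      y * T - y * (α y m * α (- y) (suc j) * S m)
        + ι (suc N) * (δ y (suc m) * δ (- y) (suc j) * (S m + h m))
        ≈⟨ +-congˡ (trans (*-congʳ N≈) (trans (sym (*-assoc _ _ _)) (*-congʳ (difference m j)))) ⟩
      y * T - y * (α y m * α (- y) (suc j) * S m)
        + - y * (α y (suc m) * α (- y) j - α y m * α (- y) (suc j)) * (S m + h m)
        ≈⟨ solve 8 (λ y t a b a′ b′ s h →
            y :* t :- y :* (a :* b′ :* s)
            :+ :- y :* (a′ :* b :- a :* b′) :* (s :+ h) :=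
            y :* (t :+ a :* b′ :* h) :- y :* (a′ :* b :* (s :+ h)))
            refl y T (α y m) (α (- y) j) (α y (suc m)) (α (- y) (suc j)) (S m) (h m) ⟩
      y * (T + α y m * α (- y) (suc j) * h m) - y * (α y (suc m) * α (- y) j * (S m + h m))
        ≡⟨ ≡.cong (λ k → y * (T + α y m * α (- y) k * h m)
             - y * (α y (suc m) * α (- y) j * (S m + h m))) (≡.sym (suc∸ m<N)) ⟩
      y * (T + tail (suc N) m) - y * (α y (suc m) * α (- y) j * (S m + h m))
        ≈⟨ +-cong (*-congˡ (sum-last +-monoid m (tail (suc N)))) (-‿cong (*-congˡ (*-congˡ S-suc))) ⟨
      y * sum {suc m} (tail (suc N) ∘ toℕ) - y * (α y (suc m) * α (- y) j * S (suc m)) ∎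
      where
      T = sum {m} (tail (suc N) ∘ toℕ)
      j = N ∸ suc m
      S-suc = sum-last +-monoid m h
      N≈ : ι (suc N) ≈ ι (suc m) + ι (suc j)
      N≈ = trans (ι-split (ℕ.≤-trans m<N (ℕ.n≤1+n N)))
             (+-congˡ (reflexive (≡.cong ι (suc∸ m<N))))

    -- At k = n the relation n δ y n = y α y (n - 1) takes the place of `difference`. It cancels the
    -- boundary term of `partial` and supplies the last `tail`.
    abel : ∀ {n} → 1 ℕ.≤ n →
           sum {suc n} (term n ∘ toℕ) ≈ y * sum {n} (tail n ∘ toℕ)
    abel {suc N} _ = begin
      sum {2 ℕ.+ N} (term (suc N) ∘ toℕ)
        ≈⟨ sum-last +-monoid (suc N) (term (suc N)) ⟩
      sum {suc N} (term (suc N) ∘ toℕ) + s * (δ y (suc N) * δ (- y) (N ∸ N) * S (suc N))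
        ≈⟨ +-cong (partial N N ℕ.≤-refl) (*-congˡ (*-congˡ (sum-last +-monoid N h))) ⟩
      y * T - y * (α y N * α (- y) (N ∸ N) * S N)
        + s * (δ y (suc N) * δ (- y) (N ∸ N) * (S N + h N))
        ≡⟨ ≡.cong (λ k → y * T - y * (α y N * α (- y) k * S N)
             + s * (δ y (suc N) * δ (- y) k * (S N + h N))) (ℕ.n∸n≡0 N) ⟩
      y * T - y * (α y N * 1# * S N) + s * (δ y (suc N) * 1# * (S N + h N))
        ≈⟨ modulo (S N + h N) (δ-α y N)
            (solve 7 (λ y t a s′ s d h →
              y :* t :- y :* (a :* :1 :* s′) :+ s :* (d :* :1 :* (s′ :+ h)) :=
              y :* (t :+ a :* :1 :* h) :+ (s′ :+ h) :* (d :* s :- y :* a))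
              refl y T (α y N) (S N) s (δ y (suc N)) (h N)) ⟩
      y * (T + α y N * 1# * h N)
        ≡⟨ ≡.cong (λ k → y * (T + α y N * α (- y) k * h N)) (≡.sym (ℕ.n∸n≡0 N)) ⟩
      y * (T + tail (suc N) N)
        ≈⟨ *-congˡ (sum-last +-monoid N (tail (suc N))) ⟨
      y * sum {suc N} (tail (suc N) ∘ toℕ) ∎
      where
      s = ι (suc N)
      T = sum {N} (tail (suc N) ∘ toℕ)

  -- The sums `A m n`, their recurrence and their closed forms.

  module _ (x y : Carrier) (u p : ℕ → Carrier) where

    A : ℕ → ℕ → Carrier
    A m n = sum {n} ((λ j → α y j * α (- y) (n ∸ suc j) * u j ^ m) ∘ toℕ)

    -- For m = 0 the reciprocals drop out and `conv-α` applies.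
    A₀ : ∀ n → A 0 n ≈ ι n
    A₀ zero    = refl
    A₀ (suc n) = trans (sum-cong-≋ {suc n} λ i → *-identityʳ (α y (toℕ i) * α (- y) (n ∸ toℕ i))) (conv-α y n)

    -- The recurrence holds term by term. Put w = `u j`, v = `u n` and d = n - 1 - j, and let β, β′
    -- be `α (- y)` at d and d + 1. From w - v = (d + 1) w v and (d + 1) β′ = (d + 1 - y) β follows
    -- β′ (w - v) = β (w - v) - y β w v. The new term j = n has w = v and is absorbed into u n * A m
    -- (suc n).
    A-suc : ∀ m n → Reciprocals x (suc n) u → A (suc m) (suc n) ≈
      u n * A m (suc n) + ((1# - y * u n) * A (suc m) n - u n * A m n)
    A-suc m n xu≈1 = begin
      A (suc m) (suc n)
        ≈⟨ sum-last +-monoid n a ⟩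
      sum {n} (a ∘ toℕ) + a n
        ≈⟨ +-congʳ (sum-linear n v (1# - y * v) v step) ⟩
      v * sum {n} (b ∘ toℕ) + ((1# - y * v) * A (suc m) n - v * A m n) + a n
        ≈⟨ solve 5 (λ v s w r q → v :* s :+ w :+ r :* (v :* q) := v :* (s :+ r :* q) :+ w)
             refl v _ _ (α y n * α (- y) (n ∸ n)) (v ^ m) ⟩
      v * (sum {n} (b ∘ toℕ) + b n) + ((1# - y * v) * A (suc m) n - v * A m n)
        ≈⟨ +-congʳ (*-congˡ (sum-last +-monoid n b)) ⟨
      v * A m (suc n) + ((1# - y * v) * A (suc m) n - v * A m n) ∎
      where
      v = u n
      a b : ℕ → Carrier
      a j = α y j * α (- y) (n ∸ j) * u j ^ suc m
      b j = α y j * α (- y) (n ∸ j) * u j ^ m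

      step : ∀ {j} → j ℕ.< n → a j ≈ v * b j +
        ((1# - y * v) * (α y j * α (- y) (n ∸ suc j) * u j ^ suc m)
          - v * (α y j * α (- y) (n ∸ suc j) * u j ^ m))
      step {j} j<n rewrite suc∸ j<n = modulo₂
        (α y j * u j ^ m * (β′ - β)) (α y j * u j ^ m * w * v) w-v (α-suc (- y) d)
        (solve 9 (λ a b b′ w v q y d o →
          a :* b′ :* (w :* q) :=
          v :* (a :* b′ :* q)
          :+ ((:1 :- y :* v) :* (a :* b :* (w :* q)) :- v :* (a :* b :* q))
          :+ a :* q :* (b′ :- b) :* ((w :- v) :- (o :+ d) :* w :* v)
          :+ a :* q :* w :* v :* (b′ :* (o :+ d) :- b :* (:- y :+ (o :+ d))))
          refl (α y j) β β′ w v (w ^ m) y (ι d) 1#)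
        where
        d = n ∸ suc j
        β = α (- y) d
        β′ = α (- y) (suc d)
        w = u j
        n≈ : ι n ≈ ι j + ι (suc d)
        n≈ = trans (ι-split (ℕ.<⇒≤ j<n)) (+-congˡ (reflexive (≡.cong ι (suc∸ j<n))))

        w-v : w - v ≈ ι (suc d) * w * v
        -- Here w = (x + n + 1) v w and v = (x + j + 1) v w; subtracting eliminates x.
        w-v = modulo (w * v) n≈ (modulo₂ (- w) v (xu≈1 (ℕ.n<1+n n)) (xu≈1 (ℕ.m<n⇒m<1+n j<n))
          (solve 7 (λ o x w v n j d → w :- v :=
            (o :+ d) :* w :* v :+ w :* v :* (n :- (j :+ (o :+ d)))
            :+ :- w :* ((x :+ (o :+ n)) :* v :- :1)
            :+ v :* ((x :+ (o :+ j)) :* w :- :1))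
            refl 1# x w v (ι n) (ι j) (ι d)))

    -- When u and p are the reciprocals belonging to x and x - y, this is the harmonic difference
    -- `Δ ℓ` of the theorem.
    P : ℕ → ℕ → Carrier
    P ℓ n = sum {n} ((λ k → p k ^ ℓ) ∘ toℕ) - sum {n} ((λ k → u k ^ ℓ) ∘ toℕ)

    P-suc : ∀ ℓ n → P ℓ (suc n) ≈ P ℓ n + (p n ^ ℓ - u n ^ ℓ)
    P-suc ℓ n = trans
      (+-cong (sum-last +-monoid n λ k → p k ^ ℓ) (-‿cong (sum-last +-monoid n λ k → u k ^ ℓ)))
      (solve 4 (λ a b c d → a :+ b :- (c :+ d) := a :- c :+ (b :- d)) refl _ _ _ _)

    f : ℕ → Carrier
    f zero    = 1#
    f (suc n) = f n * ((x - y + ι (suc n)) * u n)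

    -- Identifies `f n` with the quotient binom(x - y + n, n) / binom(x + n, n) in the theorem; the
    -- factorials cancel.
    f-α : ∀ n → Reciprocals x n u → f n * α x n ≈ α (x - y) n
    f-α zero    _    = *-identityˡ 1#
    f-α (suc n) xu≈1 = *-cancelʳ (char0 n) (begin
      f n * (s * u n) * α x (suc n) * κ   ≈⟨ *-assoc _ _ _ ⟩
      f n * (s * u n) * (α x (suc n) * κ) ≈⟨ *-congˡ (α-suc x n) ⟩
      f n * (s * u n) * (α x n * z)       ≈⟨ solve 5 (λ f s u a z → f :* (s :* u) :* (a :* z) := f :* a :* s :* (z :* u)) refl _ _ _ _ _ ⟩
      f n * α x n * s * (z * u n)         ≈⟨ *-cong (*-congʳ (f-α n (xu≈1 ∘ ℕ.m<n⇒m<1+n))) (xu≈1 (ℕ.n<1+n n)) ⟩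
      α (x - y) n * s * 1#                ≈⟨ *-identityʳ _ ⟩
      α (x - y) n * s                     ≈⟨ α-suc (x - y) n ⟨
      α (x - y) (suc n) * κ               ∎)
      where
      κ = ι (suc n)
      s = x - y + κ
      z = x + κ

    -- The polynomials in the `P ℓ` for which f″ = f · `Z₂` and f‴ = f · `Z₃`, primes being
    -- derivatives in x.
    Z₂ Z₃ : ℕ → Carrier
    Z₂ n = P 1 n ^ 2 - P 2 n
    Z₃ n = P 1 n ^ 3 + ι 2 * P 3 n - ι 3 * P 1 n * P 2 n

    -- Shows that the coefficient of `A (suc m) n` in `A-suc` is the factor leading from `f n` to
    -- `f (suc n)`.
    1-yu : ∀ {n} → Reciprocals x (suc n) u →
           1# - y * u n ≈ (x - y + ι (suc n)) * u n
    1-yu {n} xu≈1 = modulo (- 1#) (xu≈1 (ℕ.n<1+n n))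
      (solve 4 (λ x y u c → :1 :- y :* u :=
        (x :- y :+ c) :* u :+ :- :1 :* ((x :+ c) :* u :- :1)) refl x y (u n) (ι (suc n)))

    -- As functions of x, A 2, A 3 and A 4 are - A 1′, A 1″ / 2 and - A 1‴ / 6,
    -- while f′ = f · P 1 and P ℓ ′ = - ℓ · P (ℓ + 1).
    A₁ : ∀ n → Reciprocals x n u → y * A 1 n ≈ 1# - f n
    A₁ zero    _    = solve 1 (λ y → y :* con (+ 0) := :1 :- :1) refl y
    A₁ (suc n) xu≈1 = begin
      y * A 1 (suc n)
        ≈⟨ *-congˡ (trans (A-suc 0 n xu≈1)
             (+-cong (*-congˡ (A₀ (suc n))) (+-cong (*-congʳ e) (-‿cong (*-congˡ (A₀ n)))))) ⟩
      y * (v * (1# + ι n) + (s * v * A 1 n - v * ι n))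
        -- The two `A 0` contributions, v (n + 1) and v n, differ by just v.
        ≈⟨ solve 5 (λ y v n q a →
            y :* (v :* (:1 :+ n) :+ (q :* a :- v :* n)) := y :* v :+ q :* (y :* a))
            refl y v (ι n) _ _ ⟩
      y * v + s * v * (y * A 1 n)
        ≈⟨ +-congˡ (*-congˡ (A₁ n (xu≈1 ∘ ℕ.m<n⇒m<1+n))) ⟩
      y * v + s * v * (1# - f n)
        ≈⟨ modulo (- 1#) e (solve 4 (λ y v q f → y :* v :+ q :* (:1 :- f) :=
             :1 :- f :* q :+ :- :1 :* (:1 :- y :* v :- q)) refl y v (s * v) (f n)) ⟩
      1# - f n * (s * v) ∎
      where
      v = u n
      s = x - y + ι (suc n)
      e = 1-yu xu≈1

    -- The induction step common to `A₂`, `A₃` and `A₄`. There c is m!, which clears the denominator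
    -- of a Taylor coefficient.
    step : ∀ m n c {a b a′} → Reciprocals x (suc n) u →
      c * y * A (suc m) n ≈ a → c * y * A m n ≈ b → c * y * A m (suc n) ≈ a′ →
      c * y * A (suc m) (suc n) ≈
      u n * a′ + ((x - y + ι (suc n)) * u n * a - u n * b)
    step m n c {a} {b} {a′} xu≈1 ≈a ≈b ≈a′ = begin
      c * y * A (suc m) (suc n)
        ≈⟨ *-congˡ (trans (A-suc m n xu≈1) (+-congˡ (+-congʳ (*-congʳ (1-yu xu≈1))))) ⟩
      c * y * (v * A m (suc n) + (q * A (suc m) n - v * A m n))
        ≈⟨ solve 6 (λ w v q a b c → w :* (v :* a :+ (q :* b :- v :* c)) :=
             v :* (w :* a) :+ (q :* (w :* b) :- v :* (w :* c))) refl (c * y) v q _ _ _ ⟩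
      v * (c * y * A m (suc n)) + (q * (c * y * A (suc m) n) - v * (c * y * A m n))
        ≈⟨ +-cong (*-congˡ ≈a′) (+-cong (*-congˡ ≈a) (-‿cong (*-congˡ ≈b))) ⟩
      v * a′ + (q * a - v * b) ∎
      where
      v = u n
      q = (x - y + ι (suc n)) * u n

    -- Passes from the factor (m - 1)! in the formula for `A m` to the m! that `step` expects.
    rescale : ∀ {b c w a e} → b ≈ e * c → c * w ≈ a → b * w ≈ e * a
    rescale b≈ ≈a = trans (*-congʳ b≈) (trans (*-assoc _ _ _) (*-congˡ ≈a))

    A₂ : ∀ n → Reciprocals x n u → Reciprocals (x - y) n p →
         1# * y * A 2 n ≈ f n * P 1 n
    A₂ zero    _ _ = solve 1 (λ y →
      :1 :* y :* con (+ 0) := :1 :* (con (+ 0) :- con (+ 0))) refl y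
    A₂ (suc n) xu≈1 xp≈1 = begin
      1# * y * A 2 (suc n)
        ≈⟨ step 1 n 1# xu≈1 (A₂ n (xu≈1 ∘ ℕ.m<n⇒m<1+n) (xp≈1 ∘ ℕ.m<n⇒m<1+n))
             (A₁′ n (xu≈1 ∘ ℕ.m<n⇒m<1+n)) (A₁′ (suc n) xu≈1) ⟩
      v * (1# - f n * (s * v)) + (s * v * (f n * P 1 n) - v * (1# - f n))
        -- By s p = 1 the stray term f v equals f (s v) p, which supplies `p n` in the increment of
        -- `P 1`.
        ≈⟨ modulo (- (f n * v)) (xp≈1 (ℕ.n<1+n n))
            (solve 5 (λ v s p f d →
              v :* (:1 :- f :* (s :* v)) :+ (s :* v :* (f :* d) :- v :* (:1 :- f)) :=
              f :* (s :* v) :* (d :+ (p :^ 1 :- v :^ 1)) :+ :- (f :* v) :* (s :* p :- :1))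
              refl v s (p n) (f n) (P 1 n)) ⟩
      f n * (s * v) * (P 1 n + (p n ^ 1 - v ^ 1))
        ≈⟨ *-congˡ (P-suc 1 n) ⟨
      f n * (s * v) * P 1 (suc n) ∎
      where
      v = u n
      s = x - y + ι (suc n)
      A₁′ : ∀ n → Reciprocals x n u → 1# * y * A 1 n ≈ 1# - f n
      A₁′ n xu≈1 = trans (*-congʳ (*-identityˡ y)) (A₁ n xu≈1)

    A₃ : ∀ n → Reciprocals x n u → Reciprocals (x - y) n p →
         ι 2 * y * A 3 n ≈ - (f n * Z₂ n)
    A₃ zero    _ _ = solve 1 (λ y → con (+ 2) :* y :* con (+ 0) :=
      :- (:1 :* ((con (+ 0) :- con (+ 0)) :^ 2 :- (con (+ 0) :- con (+ 0))))) refl y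
    A₃ (suc n) xu≈1 xp≈1 = begin
      ι 2 * y * A 3 (suc n)
        ≈⟨ step 2 n (ι 2) xu≈1 (A₃ n xu≈1′ xp≈1′)
             (A₂′ n xu≈1′ xp≈1′) (A₂′ (suc n) xu≈1 xp≈1) ⟩
      v * (ι 2 * (f n * (s * v) * P 1 (suc n)))
        + (s * v * - (f n * Z₂ n) - v * (ι 2 * (f n * P 1 n)))
        ≈⟨ +-congʳ (*-congˡ (*-congˡ (*-congˡ (P-suc 1 n)))) ⟩
      v * (ι 2 * (f n * (s * v) * (P 1 n + (p n ^ 1 - v ^ 1))))
        + (s * v * - (f n * Z₂ n) - v * (ι 2 * (f n * P 1 n)))
        -- The cofactor is v times the value inserted for `ι 2 * y * A 2 n`; `A₄` follows the same
        -- pattern with `ι 6 * y * A 3 n`.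
        ≈⟨ modulo (ι 2 * v * f n * P 1 n) (xp≈1 (ℕ.n<1+n n))
            (solve 6 (λ v s p f d e →
              v :* (con (+ 2) :* (f :* (s :* v) :* (d :+ (p :^ 1 :- v :^ 1))))
              :+ (s :* v :* :- (f :* (d :^ 2 :- e)) :- v :* (con (+ 2) :* (f :* d))) :=
              :- (f :* (s :* v) :* ((d :+ (p :^ 1 :- v :^ 1)) :^ 2 :- (e :+ (p :^ 2 :- v :^ 2))))
              :+ con (+ 2) :* v :* f :* d :* (s :* p :- :1))
              refl v s (p n) (f n) (P 1 n) (P 2 n)) ⟩
      - (f n * (s * v) * ((P 1 n + (p n ^ 1 - v ^ 1)) ^ 2 - (P 2 n + (p n ^ 2 - v ^ 2))))
        ≈⟨ -‿cong (*-congˡ (+-cong (^-congˡ 2 (P-suc 1 n)) (-‿cong (P-suc 2 n)))) ⟨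
      - (f n * (s * v) * Z₂ (suc n)) ∎
      where
      v = u n
      s = x - y + ι (suc n)
      xu≈1′ : Reciprocals x n u
      xu≈1′ = xu≈1 ∘ ℕ.m<n⇒m<1+n
      xp≈1′ : Reciprocals (x - y) n p
      xp≈1′ = xp≈1 ∘ ℕ.m<n⇒m<1+n
      A₂′ : ∀ n → Reciprocals x n u → Reciprocals (x - y) n p →
            ι 2 * y * A 2 n ≈ ι 2 * (f n * P 1 n)
      A₂′ n xu≈1 xp≈1 = rescale
        (solve 1 (λ y → con (+ 2) :* y := con (+ 2) :* (:1 :* y)) refl y)
        (A₂ n xu≈1 xp≈1)

    A₄ : ∀ n → Reciprocals x n u → Reciprocals (x - y) n p →
         ι 6 * y * A 4 n ≈ f n * Z₃ n
    A₄ zero    _ _ = solve 1 (λ y → con (+ 6) :* y :* con (+ 0) :=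
      :1 :* ((con (+ 0) :- con (+ 0)) :^ 3 :+ con (+ 2) :* (con (+ 0) :- con (+ 0))
        :- con (+ 3) :* (con (+ 0) :- con (+ 0)) :* (con (+ 0) :- con (+ 0)))) refl y
    A₄ (suc n) xu≈1 xp≈1 = begin
      ι 6 * y * A 4 (suc n)
        ≈⟨ step 3 n (ι 6) xu≈1 (A₄ n xu≈1′ xp≈1′)
             (A₃′ n xu≈1′ xp≈1′) (A₃′ (suc n) xu≈1 xp≈1) ⟩
      v * (ι 3 * - (f n * (s * v) * Z₂ (suc n)))
        + (s * v * (f n * Z₃ n) - v * (ι 3 * - (f n * Z₂ n)))
        ≈⟨ +-congʳ (*-congˡ (*-congˡ (-‿cong (*-congˡ
             (+-cong (^-congˡ 2 (P-suc 1 n)) (-‿cong (P-suc 2 n))))))) ⟩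
      v * (ι 3 * - (f n * (s * v) * ((P 1 n + (p n ^ 1 - v ^ 1)) ^ 2 - (P 2 n + (p n ^ 2 - v ^ 2)))))
        + (s * v * (f n * Z₃ n) - v * (ι 3 * - (f n * Z₂ n)))
        ≈⟨ modulo (- (ι 3 * v * f n * Z₂ n)) (xp≈1 (ℕ.n<1+n n))
            (solve 7 (λ v s p f d e g →
              v :* (con (+ 3) :* :- (f :* (s :* v) :* ((d :+ (p :^ 1 :- v :^ 1)) :^ 2 :- (e :+ (p :^ 2 :- v :^ 2)))))
              :+ (s :* v :* (f :* (d :^ 3 :+ con (+ 2) :* g :- con (+ 3) :* d :* e))
                  :- v :* (con (+ 3) :* :- (f :* (d :^ 2 :- e)))) :=
              f :* (s :* v) :* ((d :+ (p :^ 1 :- v :^ 1)) :^ 3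
                :+ con (+ 2) :* (g :+ (p :^ 3 :- v :^ 3))
                :- con (+ 3) :* (d :+ (p :^ 1 :- v :^ 1)) :* (e :+ (p :^ 2 :- v :^ 2)))
              :+ :- (con (+ 3) :* v :* f :* (d :^ 2 :- e)) :* (s :* p :- :1))
              refl v s (p n) (f n) (P 1 n) (P 2 n) (P 3 n)) ⟩
      f n * (s * v) * ((P 1 n + (p n ^ 1 - v ^ 1)) ^ 3
        + ι 2 * (P 3 n + (p n ^ 3 - v ^ 3))
        - ι 3 * (P 1 n + (p n ^ 1 - v ^ 1)) * (P 2 n + (p n ^ 2 - v ^ 2)))
        ≈⟨ *-congˡ (+-cong (+-cong (^-congˡ 3 (P-suc 1 n)) (*-congˡ (P-suc 3 n)))
             (-‿cong (*-cong (*-congˡ (P-suc 1 n)) (P-suc 2 n)))) ⟨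
      f n * (s * v) * Z₃ (suc n) ∎
      where
      v = u n
      s = x - y + ι (suc n)
      xu≈1′ : Reciprocals x n u
      xu≈1′ = xu≈1 ∘ ℕ.m<n⇒m<1+n
      xp≈1′ : Reciprocals (x - y) n p
      xp≈1′ = xp≈1 ∘ ℕ.m<n⇒m<1+n
      A₃′ : ∀ n → Reciprocals x n u → Reciprocals (x - y) n p →
            ι 6 * y * A 3 n ≈ ι 3 * - (f n * Z₂ n)
      A₃′ n xu≈1 xp≈1 = rescale
        (solve 1 (λ y → con (+ 6) :* y := con (+ 3) :* (con (+ 2) :* y)) refl y)
        (A₃ n xu≈1 xp≈1)

  -- Both sides of the theorem in terms of `α`, `δ` and `f`.

  weight : ∀ y n k → k ℕ.≤ n → (b#0 : binom (y - ι n + ι k) k # 0#)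
           (z#0 : (y + ι k) # 0#) →
           (- 1#) ^ k * binom (ι n) k * (binom (y + ι k) k / binom (y - ι n + ι k) k [ b#0 ])
             * (y / (y + ι k) [ z#0 ]) * δ (- y) n
           ≈ δ y k * δ (- y) (n ∸ k)
  weight y n k k≤n b#0 z#0 = *-cancelʳ (*#0 b#0 z#0) (begin
    s * (a / b [ b#0 ]) * (y / z [ z#0 ]) * g * (b * z)
      ≈⟨ solve 6 (λ s a y g b z → s :* a :* y :* g :* (b :* z) := s :* g :* (a :* b) :* (y :* z))
           refl s (a / b [ b#0 ]) (y / z [ z#0 ]) g b z ⟩
    s * g * (a / b [ b#0 ] * b) * (y / z [ z#0 ] * z)
      ≈⟨ *-cong (*-cong (*-congʳ (signed-binom (ι n) k)) (/-*-cancel a b#0)) (/-*-cancel y z#0) ⟩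
    δ (- ι n) k * g * a * y
      -- Reflection yields `α (y - ι n) k`, which is the denominator b itself; `δ-shift` then
      -- disposes of y + k.
      ≈⟨ *-congʳ (*-cong (δ-reflect y n k k≤n) (binom-α y k)) ⟩
    α (y - ι n) k * δ (- y) (n ∸ k) * α y k * y
      ≈⟨ *-congʳ (*-congʳ (*-congʳ (binom-α (y - ι n) k))) ⟨
    b * δ (- y) (n ∸ k) * α y k * y
      ≈⟨ solve 4 (λ b g a y → b :* g :* a :* y := b :* g :* (y :* a)) refl _ _ _ _ ⟩
    b * δ (- y) (n ∸ k) * (y * α y k)
      ≈⟨ *-congˡ (δ-shift y k) ⟨
    b * δ (- y) (n ∸ k) * (δ y k * z)
      ≈⟨ solve 4 (λ b g d z → b :* g :* (d :* z) := d :* g :* (b :* z)) refl _ _ _ _ ⟩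
    δ y k * δ (- y) (n ∸ k) * (b * z) ∎)
    where
    s = (- 1#) ^ k * binom (ι n) k
    a = binom (y + ι k) k
    b = binom (y - ι n + ι k) k
    z = y + ι k
    g = δ (- y) n

  -1^-square : ∀ n → (- 1#) ^ n * (- 1#) ^ n ≈ 1#
  -1^-square zero    = *-identityˡ 1#
  -1^-square (suc n) = trans
    (solve 1 (λ e → :- :1 :* e :* (:- :1 :* e) := e :* e) refl ((- 1#) ^ n))
    (-1^-square n)

  module _ {n : ℕ} (n≥1 : 1 ℕ.≤ n) {x y : Carrier} {u p : ℕ → Carrier}
    (xu≈1 : Reciprocals x n u) (x-yp≈1 : Reciprocals (x - y) n p)
    where

    private
      h : ℕ → Carrier
      h k = u k ^ 4

      e = (- 1#) ^ n
      g = δ (- y) n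
      a = binom (x - y + ι n) n
      b = binom (x + ι n) n
      c = binom y n
      F′ = f x y u p n
      Z = Z₃ x y u p n

      -- The source of the sign (-1)^n in the theorem: `signed-binom` gives g = e c, and e is its
      -- own inverse.
      c≈ : c ≈ e * g
      c≈ = begin
        c             ≈⟨ *-identityˡ c ⟨
        1# * c        ≈⟨ *-congʳ (-1^-square n) ⟨
        e * e * c     ≈⟨ *-assoc e e c ⟩
        e * (e * c)   ≈⟨ *-congˡ (signed-binom y n) ⟩
        e * g         ∎

    summand≈ : ∀ {k} → k ℕ.≤ n → {b#0 : binom (y - ι n + ι k) k # 0#}
      {z#0 : (y + ι k) # 0#} {Hₖ : Carrier} → Hₖ ≈ S y h k →
      (- 1#) ^ k * binom (ι n) k * (binom (y + ι k) k / binom (y - ι n + ι k) k [ b#0 ])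
        * (y / (y + ι k) [ z#0 ]) * Hₖ * g
      ≈ δ y k * δ (- y) (n ∸ k) * S y h k
    summand≈ {k} k≤n {b#0} {z#0} {Hₖ} Hₖ≈ = trans
      (solve 3 (λ w h g → w :* h :* g := w :* g :* h) refl _ Hₖ g)
      (*-cong (weight y n k k≤n b#0 z#0) Hₖ≈)

    -- Multiplied by n g, the sum becomes that of `term`, which `abel` turns into y A 4, and `A₄`
    -- evaluates the latter. The summands are opaque here, with the first one split off because the
    -- sum over `Fin (suc n)` reduces to this shape.
    lhs≈ : {t₀ : Carrier} {t : Fin n → Carrier} →
      t₀ * g ≈ δ y 0 * δ (- y) n * S y h 0 →
      (∀ i → let k = suc (toℕ i) in t i * g ≈ δ y k * δ (- y) (n ∸ k) * S y h k) →
      (t₀ + sum {n} t) * (ι (6 ℕ.* n) * c) ≈ e * (F′ * Z)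
    lhs≈ {t₀} {t} t₀≈ t≈ = begin
      Q * (ι (6 ℕ.* n) * c)
        ≈⟨ *-congˡ (*-cong (×1-homo-* 6 n) c≈) ⟩
      Q * (ι 6 * ι n * (e * g))
        ≈⟨ solve 5 (λ q s n e g → q :* (s :* n :* (e :* g)) := e :* (s :* (n :* g :* q)))
             refl Q (ι 6) (ι n) e g ⟩
      e * (ι 6 * (ι n * g * Q))
        ≈⟨ *-congˡ (*-congˡ Q≈) ⟩
      e * (ι 6 * (y * A x y u p 4 n))
        ≈⟨ *-congˡ (trans (sym (*-assoc _ _ _)) (A₄ x y u p n xu≈1 x-yp≈1)) ⟩
      e * (F′ * Z) ∎
      where
      s : Fin (suc n) → Carrier
      s zero    = t₀
      s (suc i) = t i

      Q = sum {suc n} s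

      scale : ∀ {t d} → t * g ≈ d → ι n * g * t ≈ ι n * d
      scale tg≈d = trans (*-assoc _ _ _) (*-congˡ (trans (*-comm _ _) tg≈d))

      s≈ : ∀ k → ι n * g * s k ≈ term y h n (toℕ k)
      s≈ zero    = scale t₀≈
      s≈ (suc i) = scale (t≈ i)

      Q≈ : ι n * g * Q ≈ y * A x y u p 4 n
      Q≈ = begin
        ι n * g * Q                               ≈⟨ *-distribˡ-sum {suc n} (ι n * g) s ⟩
        sum {suc n} (λ k → ι n * g * s k)         ≈⟨ sum-cong-≋ {suc n} s≈ ⟩
        sum {suc n} (term y h n ∘ toℕ)            ≈⟨ abel y h n≥1 ⟩
        y * A x y u p 4 n                         ∎

    -- The factor 6 n clears the first quotient; c reduces the second to a / b, which `f-α`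
    -- identifies with `F′`.
    rhs≈ : {6n#0 : ι (6 ℕ.* n) # 0#} (b#0 : b # 0#) {bc#0 : (b * c) # 0#}
      {D₁ D₂ D₃ : Carrier} →
      D₁ ≈ P x y u p 1 n → D₂ ≈ P x y u p 2 n → D₃ ≈ P x y u p 3 n →
      (e / ι (6 ℕ.* n) [ 6n#0 ]) * (a / (b * c) [ bc#0 ])
        * (D₁ ^ 3 + ι 2 * D₃ - ι 3 * D₁ * D₂) * (ι (6 ℕ.* n) * c)
      ≈ e * (F′ * Z)
    rhs≈ {6n#0} b#0 {bc#0} {D₁} {D₂} {D₃} D₁≈ D₂≈ D₃≈ = begin
      r * q * Z′ * (ι (6 ℕ.* n) * c)
        ≈⟨ solve 5 (λ r s q c z → r :* q :* z :* (s :* c) := r :* s :* (q :* c :* z))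
             refl r (ι (6 ℕ.* n)) q c Z′ ⟩
      r * ι (6 ℕ.* n) * (q * c * Z′)
        ≈⟨ *-cong (/-*-cancel e 6n#0) (*-cong q*c≈ (+-cong
             (+-cong (^-congˡ 3 D₁≈) (*-congˡ D₃≈))
             (-‿cong (*-cong (*-congˡ D₁≈) D₂≈)))) ⟩
      e * (F′ * Z) ∎
      where
      q = a / (b * c) [ bc#0 ]
      r = e / ι (6 ℕ.* n) [ 6n#0 ]
      Z′ = D₁ ^ 3 + ι 2 * D₃ - ι 3 * D₁ * D₂

      q*c≈ : q * c ≈ F′
      q*c≈ = *-cancelʳ b#0 (begin
        q * c * b         ≈⟨ solve 3 (λ q c b → q :* c :* b := q :* (b :* c)) refl q c b ⟩
        q * (b * c)       ≈⟨ /-*-cancel a bc#0 ⟩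
        a                 ≈⟨ binom-α (x - y) n ⟩
        α (x - y) n       ≈⟨ f-α x y u p n xu≈1 ⟨
        F′ * α x n        ≈⟨ *-congˡ (binom-α x n) ⟨
        F′ * b            ∎)

theorem12 :
    ∀ {c ℓ₁ ℓ₂} (F : HeytingField c ℓ₁ ℓ₂) (char0 : CharacteristicZero F) →
    let open HeytingField F
        open Harmonic F char0
    in
    ∀ (n : ℕ) (n≥1 : 1 ℕ.≤ n) (x y : Carrier)
      (x∉ : x ∉ℤ[ ℤ.- + n ⋯ -1ℤ ])
      (x-y∉ : (x - y) ∉ℤ[ ℤ.- + n ⋯ -1ℤ ])
      (y∉ : y ∉ℤ[ ℤ.- + n ⋯ + n ℤ.- + 1 ]) →
    let Δ : ℕ → Carrier
        Δ ℓ = H ℓ n (x - y) x-y∉ - H ℓ n x x∉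
    in
    ∑[ k ≤ n ]
      ( (- 1#) ^ toℕ k
      * binom (ι n) (toℕ k)
      * (binom (y + ι (toℕ k)) (toℕ k)
          / binom (y - ι n + ι (toℕ k)) (toℕ k) [ binom[y-n+k,k]#0 y∉ k ])
      * (y / (y + ι (toℕ k)) [ y+k#0 y∉ n≥1 k ])
      * H 4 (toℕ k) x (∉-≤ x∉ k) )
    ≈ ((- 1#) ^ n / ι (6 ℕ.* n) [ ι#0 (6n≥1 n≥1) ])
      * (binom (x - y + ι n) n
          / (binom (x + ι n) n * binom y n)
          [ *#0 (binom[u+n,n]#0 x∉) (binom[y,n]#0 y∉) ])
      * ( Δ 1 ^ 3 + ι 2 * Δ 3 - ι 3 * Δ 1 * Δ 2 )
theorem12 F char0 n n≥1 x y x∉ x-y∉ y∉ =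
  -- After multiplication by 6 n binom(y, n) both sides equal (-1)^n f · `Z₃`.
  *-cancelʳ (*#0 (ι#0 (6n≥1 n≥1)) (binom[y,n]#0 y∉))
    (trans
      (lhs≈ n≥1 xu≈1 x-yp≈1
        -- The term k = 0, where the harmonic number is the empty sum.
        (summand≈ n≥1 xu≈1 x-yp≈1 z≤n refl)
        λ i → summand≈ n≥1 xu≈1 x-yp≈1 (Fin.toℕ<n i)
          (H-suc≈ 4 λ j≤i → xu≈1 (ℕ.≤-trans j≤i (Fin.toℕ<n i))))
      (sym (rhs≈ n≥1 xu≈1 x-yp≈1 (binom[u+n,n]#0 x∉) (D≈ 1) (D≈ 2) (D≈ 3))))
  where
  open HeytingField F
  open Harmonic F char0
  open Proof F char0

  ∃u = reciprocals n (λ k → x + ι (suc k)) (u+k#0 x∉)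
  ∃p = reciprocals n (λ k → x - y + ι (suc k)) (u+k#0 x-y∉)

  xu≈1 : Reciprocals x n (proj₁ ∃u)
  xu≈1 = proj₂ ∃u

  x-yp≈1 : Reciprocals (x - y) n (proj₁ ∃p)
  x-yp≈1 = proj₂ ∃p

  D≈ : ∀ ℓ {x#0 x-y#0} → _ ≈ P x y (proj₁ ∃u) (proj₁ ∃p) ℓ n
  D≈ ℓ {x#0} {x-y#0} = +-cong (H≈ ℓ x-yp≈1 {x-y#0}) (-‿cong (H≈ ℓ xu≈1 {x#0}))
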